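{- If $T$ is a tree, then $\alpha_{\rm es}(T)\geq \ell(T)-s(T)$, where equality holds if and only if $V(T)=S(T)\cup L(T)$ and $s(v) \leq \ell(v)-1$ for every $v\in S(T)$.
   Context: All graphs are finite and simple. For a graph $G$ and a vertex $v$, $N(v)$ is the set of neighbors of $v$ and $N[v]=N(v)\cup\{v\}$. For $B\subseteq V(G)$, $N[B]=\bigcup_{b\in B}N[b]$ and $N(B)=N[B]-B$. A set $B\subseteq V(G)$ is an externally supported independence set (ESI-set) if $B$ is independent and every $v\in N(B)$ has a neighbor in $V(G)-N[B]$ (the empty set is an ESI-set); $\alpha_{\rm es}(G)$ is the maximum cardinality of an ESI-set of $G$. A leaf is a vertex of degree $1$, and the neighbor of a leaf is called its support vertex (in particular, both vertices of $K_2$ are leaves and support vertices). $L(T)$ is the set of all leaves of $T$ and $S(T)$ is the set of all support vertices of $T$; $\ell(T)=|L(T)|$ and $s(T)=|S(T)|$. For a vertex $v$, $\ell(v)$ is the number of leaves adjacent to $v$ and $s(v)$ is the number of support vertices adjacent to $v$.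
   Formalization: The equivalence is stated only for trees whose order is not 2: it fails for K₂, where α_es = 0 = ℓ − s and V = S ∪ L, but s(v) = 1 > 0 = ℓ(v) − 1; the inequality is stated for every tree. -}

module Defs where

open import Data.Bool.Base using (true; false)
open import Data.Fin.Base using (Fin)
open import Data.Fin.Properties using (any?; all?)
open import Data.Fin.Subset
open import Data.Fin.Subset.Properties using (_∈?_; ∉⊥; p─q⊆p)
open import Data.List.Base as List using (List; []; _∷_; _∷ʳ_; _++_; length; filter)
open import Data.List.Extrema.Nat using (argmax; argmax-all; f[xs]≤f[argmax])
open import Data.List.Membership.Propositional as ListMem using ()
open import Data.List.Membership.Propositional.Properties
  using (∈-map⁺; ∈-++⁺ˡ; ∈-++⁺ʳ; ∈-filter⁺)
import Data.List.Relation.Unary.All as All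
open import Data.List.Relation.Unary.All.Properties using (all-filter)
open import Data.List.Relation.Unary.Any using (here)
open import Data.List.Relation.Unary.Linked using (Linked)
open import Data.List.Relation.Unary.Unique.Propositional using (Unique)
open import Data.Nat.Base using (ℕ; zero; suc; _≤_)
import Data.Nat.Properties as ℕ
open import Data.Product.Base using (∃-syntax; _×_; _,_)
open import Data.Vec.Base as Vec using (tabulate)
open import Data.Vec.Properties using (lookup⇒[]=; []=⇒lookup; lookup∘tabulate)
open import Function.Base using (_∘_)
open import Level using (0ℓ)
open import Relation.Binary.Construct.Closure.ReflexiveTransitive using (Star)
open import Relation.Binary.Core using (Rel)
open import Relation.Binary.Definitions using (Decidable; Symmetric)
open import Relation.Binary.PropositionalEquality using (_≡_; refl; sym; trans)
open import Relation.Nullary using (¬_; does; yes; no; contradiction)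
open import Relation.Nullary.Decidable using (_×-dec_; _→-dec_; ¬?; dec-true)
import Relation.Unary as U

private
  variable
    n : ℕ

record Graph (n : ℕ) : Set₁ where
  field
    Adj     : Rel (Fin n) 0ℓ
    adj?    : Decidable Adj
    adj-sym : Symmetric Adj
    irrefl  : ∀ {v} → ¬ Adj v v

-- ⟪ P? ⟫ is the set { v | P v }.
⟪_⟫ : {P : U.Pred (Fin n) 0ℓ} → U.Decidable P → Subset n
⟪ P? ⟫ = tabulate (does ∘ P?)

∈⟪⟫⁺ : {P : U.Pred (Fin n) 0ℓ} (P? : U.Decidable P) → ∀ {v} → P v → v ∈ ⟪ P? ⟫
∈⟪⟫⁺ P? {v} p =
  lookup⇒[]= v _ (trans (lookup∘tabulate (does ∘ P?) v) (dec-true (P? v) p))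

∈⟪⟫⁻ : {P : U.Pred (Fin n) 0ℓ} (P? : U.Decidable P) → ∀ {v} → v ∈ ⟪ P? ⟫ → P v
∈⟪⟫⁻ P? {v} v∈ with P? v | trans (sym (lookup∘tabulate (does ∘ P?) v)) ([]=⇒lookup v∈)
... | yes p | _ = p

subsets : ∀ n → List (Subset n)
subsets zero    = Vec.[] ∷ []
subsets (suc n) =
  List.map (inside Vec.∷_) (subsets n) ++ List.map (outside Vec.∷_) (subsets n)

∈-subsets : (p : Subset n) → p ListMem.∈ subsets n
∈-subsets Vec.[]          = here refl
∈-subsets (true  Vec.∷ p) = ∈-++⁺ˡ (∈-map⁺ _ (∈-subsets p))
∈-subsets (false Vec.∷ p) = ∈-++⁺ʳ _ (∈-map⁺ _ (∈-subsets p))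

module _ (G : Graph n) where
  open Graph G

  N : Fin n → Subset n
  N v = ⟪ adj? v ⟫

  N[_] : Fin n → Subset n
  N[ v ] = N v ∪ ⁅ v ⁆

  inN[]? : (B : Subset n) → U.Decidable (λ v → ∃[ b ] (b ∈ B × v ∈ N[ b ]))
  inN[]? B v = any? (λ b → (b ∈? B) ×-dec (v ∈? N[ b ]))

  -- N[B], the union of the N[b] over b ∈ B.
  N[_]ˢ : Subset n → Subset n
  N[ B ]ˢ = ⟪ inN[]? B ⟫

  Nˢ : Subset n → Subset n
  Nˢ B = N[ B ]ˢ ─ B

  Independent : Subset n → Set
  Independent B = ∀ u → u ∈ B → ∀ v → v ∈ B → ¬ Adj u v

  ExternallySupported : Subset n → Set
  ExternallySupported B = ∀ v → v ∈ Nˢ B → ∃[ w ] (Adj v w × w ∈ ∁ N[ B ]ˢ)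

  ESI : Subset n → Set
  ESI B = Independent B × ExternallySupported B

  esi? : U.Decidable ESI
  esi? B =
    all? (λ u → (u ∈? B) →-dec all? (λ v → (v ∈? B) →-dec ¬? (adj? u v)))
    ×-dec
    all? (λ v → (v ∈? Nˢ B) →-dec any? (λ w → adj? v w ×-dec (w ∈? ∁ N[ B ]ˢ)))

  ESI-⊥ : ESI ⊥
  ESI-⊥ = (λ _ u∈⊥ → contradiction u∈⊥ ∉⊥) , λ v v∈ →
    let _ , b∈⊥ , _ = ∈⟪⟫⁻ (inN[]? ⊥) (p─q⊆p N[ ⊥ ]ˢ ⊥ v∈) in contradiction b∈⊥ ∉⊥

  esiSets : List (Subset n)
  esiSets = filter esi? (subsets n)

  αₑₛ : ℕ
  αₑₛ = ∣ argmax ∣_∣ ⊥ esiSets ∣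

  αₑₛ-attained : ∃[ B ] (ESI B × ∣ B ∣ ≡ αₑₛ)
  αₑₛ-attained = argmax ∣_∣ ⊥ esiSets ,
    argmax-all ∣_∣ ESI-⊥ (all-filter esi? (subsets n)) , refl

  αₑₛ-maximal : ∀ B → ESI B → ∣ B ∣ ≤ αₑₛ
  αₑₛ-maximal B esi = All.lookup (f[xs]≤f[argmax] ⊥ esiSets)
    (∈-filter⁺ esi? (∈-subsets B) esi)

  degree : Fin n → ℕ
  degree v = ∣ N v ∣

  Leaf : Fin n → Set
  Leaf v = degree v ≡ 1

  leaf? : U.Decidable Leaf
  leaf? v = degree v ℕ.≟ 1

  Support : Fin n → Set
  Support v = ∃[ u ] (Leaf u × Adj u v)

  support? : U.Decidable Support
  support? v = any? (λ u → leaf? u ×-dec adj? u v)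

  L : Subset n
  L = ⟪ leaf? ⟫

  S : Subset n
  S = ⟪ support? ⟫

  ℓ : ℕ
  ℓ = ∣ L ∣

  s : ℕ
  s = ∣ S ∣

  ℓᵥ : Fin n → ℕ
  ℓᵥ v = ∣ N v ∩ L ∣

  sᵥ : Fin n → ℕ
  sᵥ v = ∣ N v ∩ S ∣

  Connected : Set
  Connected = ∀ u v → Star Adj u v

  -- A cycle v, vs, v of length at least 3.
  IsCycle : Fin n → List (Fin n) → Set
  IsCycle v vs = Unique (v ∷ vs) × 2 ≤ length vs × Linked Adj (v ∷ vs ∷ʳ v)

  Acyclic : Set
  Acyclic = ∀ v vs → ¬ IsCycle v vs

  record IsTree : Set where
    field
      nonempty  : Fin n
      connected : Connected
      acyclic   : Acyclic

{-# OPTIONS --safe #-}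
module Submission where

-- Choose one leaf c(v) at every support vertex v. The set of the leaves other than
-- the c(v) is an ESI-set with ℓ - s elements, because c(v) supports v externally.
-- Given a vertex v that is not a leaf, one may instead use v to support its
-- neighbours, which gains their chosen leaves and costs the leaves at v; comparison
-- with α = ℓ - s gives s(v) < ℓ(v) for v ∈ S, and shows that a vertex outside S ∪ L
-- has no neighbours in S ∪ L, hence that T is a single vertex, for which α = 1.
-- Conversely, if V = S ∪ L, an ESI-set B consists of leaves, and |S| ≤ |L - B|
-- is proved by charging each support vertex to leaves outside B.

open import Defs
open import Algebra.Bundles using (AbelianGroup)
import Algebra.Properties.CommutativeMonoid.Sum
import Algebra.Properties.Group
open import Data.Bool.Base using (true; false)
open import Data.Fin.Base using (Fin; zero; suc)
open import Data.Fin.Properties using (any?; _≟_)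
open import Data.Fin.Subset
  using (Subset; _∈_; _∉_; _⊆_; _⊂_; _∪_; _∩_; _─_; ⊤; ⊥; ⁅_⁆; ∁; ∣_∣)
open import Data.Fin.Subset.Properties
open import Data.Integer using (+_; _-_; _≤_; _≥_)
import Data.Integer as ℤ
import Data.Integer.Properties as ℤ
open import Data.List.Base using (List; []; _∷_; _∷ʳ_; length)
import Data.List.Membership.DecPropositional as DecMembership
open import Data.List.Membership.Propositional renaming (_∈_ to _∈ˡ_) using ()
open import Data.List.Relation.Unary.All as All using (All; []; _∷_)
open import Data.List.Relation.Unary.All.Properties using (¬Any⇒All¬)
open import Data.List.Relation.Unary.AllPairs using ([]; _∷_)
open import Data.List.Relation.Unary.Any using (here; there)
open import Data.List.Relation.Unary.Linked using (Linked; [-]; _∷_)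
open import Data.List.Relation.Unary.Unique.Propositional using (Unique)
open import Data.Nat using (ℕ; zero; suc; _+_; z≤n; s≤s)
import Data.Nat as ℕ
import Data.Nat.Properties as ℕ
open import Data.Nat.Tactic.RingSolver using (solve-∀)
open import Data.Product using (_×_; _,_; proj₁; proj₂; ∃; ∃-syntax)
open import Data.Sum as Sum using (_⊎_; inj₁; inj₂; [_,_]′)
import Data.Vec.Base as Vec
open import Data.Vec.Functional using (Vector)
open import Function.Base using (_∘_; id)
open import Function.Bundles using (_⇔_; mk⇔)
open import Relation.Binary.Construct.Closure.ReflexiveTransitive using (Star; ε; _◅_)
open import Relation.Binary.PropositionalEquality
  using (_≡_; _≢_; refl; sym; trans; cong; cong₂; subst)
open import Relation.Nullary using (¬_; Dec; yes; no; contradiction; decidable-stable)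
open import Relation.Nullary.Decidable using (_×-dec_; ¬?)

open Algebra.Properties.CommutativeMonoid.Sum ℕ.+-0-commutativeMonoid
  using (sum; ∑-distrib-+; sum-cong-≗; sum-replicate-zero)

open Algebra.Properties.Group (AbelianGroup.group ℤ.+-0-abelianGroup)
  using (//-rightDividesˡ; //-rightDividesʳ)

private
  variable
    k m n : ℕ

-- Cardinalities of finite sets

x∈p─q⇒x∉q : ∀ (p q : Subset n) {x} → x ∈ p ─ q → x ∉ q
x∈p─q⇒x∉q (_ Vec.∷ p) (true  Vec.∷ q) (Vec.there x∈) (Vec.there x∈q) = x∈p─q⇒x∉q p q x∈ x∈q
x∈p─q⇒x∉q (_ Vec.∷ p) (false Vec.∷ q) (Vec.there x∈) (Vec.there x∈q) = x∈p─q⇒x∉q p q x∈ x∈q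

∣p─q∣+∣p∩q∣≡∣p∣ : ∀ (p q : Subset n) → ∣ p ─ q ∣ + ∣ p ∩ q ∣ ≡ ∣ p ∣
∣p─q∣+∣p∩q∣≡∣p∣ Vec.[] Vec.[] = refl
∣p─q∣+∣p∩q∣≡∣p∣ (true  Vec.∷ p) (true  Vec.∷ q) =
  trans (ℕ.+-suc ∣ p ─ q ∣ ∣ p ∩ q ∣) (cong suc (∣p─q∣+∣p∩q∣≡∣p∣ p q))
∣p─q∣+∣p∩q∣≡∣p∣ (true  Vec.∷ p) (false Vec.∷ q) = cong suc (∣p─q∣+∣p∩q∣≡∣p∣ p q)
∣p─q∣+∣p∩q∣≡∣p∣ (false Vec.∷ p) (true  Vec.∷ q) = ∣p─q∣+∣p∩q∣≡∣p∣ p q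
∣p─q∣+∣p∩q∣≡∣p∣ (false Vec.∷ p) (false Vec.∷ q) = ∣p─q∣+∣p∩q∣≡∣p∣ p q

∣p∪q∣≤∣p∣+∣q∣ : ∀ (p q : Subset n) → ∣ p ∪ q ∣ ℕ.≤ ∣ p ∣ + ∣ q ∣
∣p∪q∣≤∣p∣+∣q∣ Vec.[] Vec.[] = z≤n
∣p∪q∣≤∣p∣+∣q∣ (true  Vec.∷ p) (true  Vec.∷ q) =
  s≤s (ℕ.≤-trans (∣p∪q∣≤∣p∣+∣q∣ p q) (ℕ.+-monoʳ-≤ ∣ p ∣ (ℕ.n≤1+n ∣ q ∣)))
∣p∪q∣≤∣p∣+∣q∣ (true  Vec.∷ p) (false Vec.∷ q) = s≤s (∣p∪q∣≤∣p∣+∣q∣ p q)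
∣p∪q∣≤∣p∣+∣q∣ (false Vec.∷ p) (true  Vec.∷ q) =
  ℕ.≤-trans (s≤s (∣p∪q∣≤∣p∣+∣q∣ p q)) (ℕ.≤-reflexive (sym (ℕ.+-suc ∣ p ∣ ∣ q ∣)))
∣p∪q∣≤∣p∣+∣q∣ (false Vec.∷ p) (false Vec.∷ q) = ∣p∪q∣≤∣p∣+∣q∣ p q

∣p∣≤∣p─q∣+∣q∣ : ∀ (p q : Subset n) → ∣ p ∣ ℕ.≤ ∣ p ─ q ∣ + ∣ q ∣
∣p∣≤∣p─q∣+∣q∣ p q = ℕ.≤-trans (ℕ.≤-reflexive (sym (∣p─q∣+∣p∩q∣≡∣p∣ p q)))
  (ℕ.+-monoʳ-≤ ∣ p ─ q ∣ (∣p∩q∣≤∣q∣ p q))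

x∉p⇒∣p∣≤k : ∀ {p : Subset n} {k} → (∀ {x} → x ∉ p) → ∣ p ∣ ℕ.≤ k
x∉p⇒∣p∣≤k {n} x∉p = ℕ.≤-trans (p⊆q⇒∣p∣≤∣q∣ {q = ⊥} (λ x∈ → contradiction x∈ x∉p))
  (ℕ.≤-trans (ℕ.≤-reflexive (∣⊥∣≡0 n)) z≤n)

x∈p⇒1≤∣p∣ : ∀ {p : Subset n} {x} → x ∈ p → 1 ℕ.≤ ∣ p ∣
x∈p⇒1≤∣p∣ {p = p} {x} x∈p = subst (ℕ._≤ ∣ p ∣) (∣⁅x⁆∣≡1 x)
  (p⊆q⇒∣p∣≤∣q∣ (λ y∈ → subst (_∈ p) (sym (x∈⁅y⁆⇒x≡y x y∈)) x∈p))

p⊆⁅x⁆⇒∣p∣≤1 : ∀ {p : Subset n} {x} → (∀ {y} → y ∈ p → y ≡ x) → ∣ p ∣ ℕ.≤ 1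
p⊆⁅x⁆⇒∣p∣≤1 {p = p} {x} ⊆x = subst (∣ p ∣ ℕ.≤_) (∣⁅x⁆∣≡1 x)
  (p⊆q⇒∣p∣≤∣q∣ (λ y∈ → subst (_∈ ⁅ x ⁆) (sym (⊆x y∈)) (x∈⁅x⁆ x)))

∣p∣≡1⇒x≡y : ∀ {p : Subset n} {x y} → ∣ p ∣ ≡ 1 → x ∈ p → y ∈ p → x ≡ y
∣p∣≡1⇒x≡y {p = p} {x} {y} ∣p∣≡1 x∈p y∈p = decidable-stable (x ≟ y) λ x≢y →
  ℕ.<-irrefl (sym ∣p∣≡1) (ℕ.≤-<-trans (x∈p⇒1≤∣p∣ (x∈p∧x≢y⇒x∈p-y x∈p x≢y)) (x∈p⇒∣p-x∣<∣p∣ y∈p))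

Unique⇒length≤∣p∣ : ∀ {p : Subset n} {xs} → Unique xs → All (_∈ p) xs → length xs ℕ.≤ ∣ p ∣
Unique⇒length≤∣p∣ []          []           = z≤n
Unique⇒length≤∣p∣ (x≢ ∷ uniq) (x∈p ∷ xs∈p) = ℕ.≤-<-trans
  (Unique⇒length≤∣p∣ uniq
    (All.zipWith (λ (x≢y , y∈p) → x∈p∧x≢y⇒x∈p-y y∈p (x≢y ∘ sym)) (x≢ , xs∈p)))
  (x∈p⇒∣p-x∣<∣p∣ x∈p)

fibre : (Fin m → Fin n) → Fin n → Subset m
fibre f w = ⟪ (λ x → f x ≟ w) ⟫

∈fibre⁺ : ∀ (f : Fin m → Fin n) {w x} → f x ≡ w → x ∈ fibre f w
∈fibre⁺ f {w} = ∈⟪⟫⁺ (λ x → f x ≟ w)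

∈fibre⁻ : ∀ (f : Fin m → Fin n) {w x} → x ∈ fibre f w → f x ≡ w
∈fibre⁻ f {w} = ∈⟪⟫⁻ (λ x → f x ≟ w)

sum-mono-≤ : ∀ {f g : Vector ℕ n} → (∀ i → f i ℕ.≤ g i) → sum f ℕ.≤ sum g
sum-mono-≤ {zero}  f≤g = z≤n
sum-mono-≤ {suc n} f≤g = ℕ.+-mono-≤ (f≤g zero) (sum-mono-≤ (f≤g ∘ suc))

[_==_] : Fin n → Fin n → ℕ
[ x == w ] with x ≟ w
... | yes _ = 1
... | no  _ = 0

∑[x==w]≡1 : ∀ (x : Fin n) → sum (λ w → [ x == w ]) ≡ 1
∑[x==w]≡1 {suc n} zero    = cong suc (sum-replicate-zero n)
∑[x==w]≡1 {suc n} (suc x) = trans (sum-cong-≗ suc-==) (∑[x==w]≡1 x)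
  where
  suc-== : ∀ w → [ suc x == suc w ] ≡ [ x == w ]
  suc-== w with x ≟ w
  ... | yes _ = refl
  ... | no  _ = refl

-- Every element lies in exactly one fibre. In the induction the head of the vector contributes the
-- indicator of its value under `f`.
∣p∣≡∑∣fibre∣ : ∀ (f : Fin m → Fin n) p → ∣ p ∣ ≡ sum (λ w → ∣ p ∩ fibre f w ∣)
∣p∣≡∑∣fibre∣ {n = n} f Vec.[] = sym (sum-replicate-zero n)
∣p∣≡∑∣fibre∣ f (false Vec.∷ p) = ∣p∣≡∑∣fibre∣ (f ∘ suc) p
∣p∣≡∑∣fibre∣ f (true  Vec.∷ p) = sym (trans (sum-cong-≗ head-tail)
  (trans (∑-distrib-+ (λ w → [ f zero == w ]) (λ w → ∣ p ∩ fibre (f ∘ suc) w ∣))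
    (cong₂ _+_ (∑[x==w]≡1 (f zero)) (sym (∣p∣≡∑∣fibre∣ (f ∘ suc) p)))))
  where
  head-tail : ∀ w → ∣ (true Vec.∷ p) ∩ fibre f w ∣
                  ≡ [ f zero == w ] + ∣ p ∩ fibre (f ∘ suc) w ∣
  head-tail w with f zero ≟ w
  ... | yes _ = refl
  ... | no  _ = refl

-- Stands in for an explicit injection: two sets spread over a common index set are compared one
-- index at a time. The charging argument relies on this, since one vertex may receive several
-- charges.
fibrewise-≤ : ∀ (f : Fin k → Fin n) (g : Fin m → Fin n) p q →
  (∀ w → ∣ p ∩ fibre f w ∣ ℕ.≤ ∣ q ∩ fibre g w ∣) → ∣ p ∣ ℕ.≤ ∣ q ∣
fibrewise-≤ f g p q p≤q = begin
  ∣ p ∣                          ≡⟨ ∣p∣≡∑∣fibre∣ f p ⟩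
  sum (λ w → ∣ p ∩ fibre f w ∣)  ≤⟨ sum-mono-≤ p≤q ⟩
  sum (λ w → ∣ q ∩ fibre g w ∣)  ≡⟨ ∣p∣≡∑∣fibre∣ g q ⟨
  ∣ q ∣                          ∎
  where open ℕ.≤-Reasoning

inImage? : ∀ (f : Fin m → Fin n) p w → Dec (∃[ v ] (v ∈ p × f v ≡ w))
inImage? f p w = any? (λ v → (v ∈? p) ×-dec (f v ≟ w))

image : (Fin m → Fin n) → Subset m → Subset n
image f p = ⟪ inImage? f p ⟫

∈image⁺ : ∀ (f : Fin m → Fin n) {p v} → v ∈ p → f v ∈ image f p
∈image⁺ f {p} v∈p = ∈⟪⟫⁺ (inImage? f p) (_ , v∈p , refl)

∣image∣≤ : ∀ (f : Fin m → Fin n) p → ∣ image f p ∣ ℕ.≤ ∣ p ∣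
∣image∣≤ f p = fibrewise-≤ id f (image f p) p fibre-≤
  where
  fibre-≤ : ∀ w → ∣ image f p ∩ fibre id w ∣ ℕ.≤ ∣ p ∩ fibre f w ∣
  fibre-≤ w with inImage? f p w
  ... | yes (v , v∈p , fv≡w) = ℕ.≤-trans
    (p⊆⁅x⁆⇒∣p∣≤1 (∈fibre⁻ id ∘ p∩q⊆q (image f p) _))
    (x∈p⇒1≤∣p∣ (x∈p∩q⁺ (v∈p , ∈fibre⁺ f fv≡w)))
  ... | no w∉ = x∉p⇒∣p∣≤k λ x∈ → let x∈im , x∈w = x∈p∩q⁻ (image f p) _ x∈ in
    w∉ (subst (λ y → ∃[ v ] (v ∈ p × f v ≡ y)) (∈fibre⁻ id x∈w) (∈⟪⟫⁻ (inImage? f p) x∈im))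

-- Cycles

module _ {A : Set} where

  -- The prefix ending at the occurrence recorded by the membership proof, with `z` as its last
  -- entry.
  takeTo : ∀ {z : A} {xs} → z ∈ˡ xs → List A
  takeTo (here  {x} _) = x ∷ []
  takeTo (there {x} i) = x ∷ takeTo i

  1≤∣takeTo∣ : ∀ {z : A} {xs} (i : z ∈ˡ xs) → 1 ℕ.≤ length (takeTo i)
  1≤∣takeTo∣ (here _)  = s≤s z≤n
  1≤∣takeTo∣ (there _) = s≤s z≤n

  All-takeTo⁺ : ∀ {P : A → Set} {z xs} (i : z ∈ˡ xs) → All P xs → All P (takeTo i)
  All-takeTo⁺ (here _)  (px ∷ _)   = px ∷ []
  All-takeTo⁺ (there i) (px ∷ pxs) = px ∷ All-takeTo⁺ i pxs

  Unique-takeTo⁺ : ∀ {z : A} {xs} (i : z ∈ˡ xs) → Unique xs → Unique (takeTo i)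
  Unique-takeTo⁺ (here _)  _           = [] ∷ []
  Unique-takeTo⁺ (there i) (x≢ ∷ uniq) = All-takeTo⁺ i x≢ ∷ Unique-takeTo⁺ i uniq

  -- An edge from `z` back to `x` replaces whatever follows `z` on the path; this closes the cycle
  -- in `acyclic⇒leaf`.
  Linked-takeTo⁺ : ∀ {R : A → A → Set} {x y z xs} (i : z ∈ˡ xs) →
    Linked R (y ∷ xs) → R z x → Linked R (y ∷ takeTo i ∷ʳ x)
  Linked-takeTo⁺ (here refl) (Ryz ∷ _)   Rzx = Ryz ∷ Rzx ∷ [-]
  Linked-takeTo⁺ (there i)   (Ryw ∷ Rxs) Rzx = Ryw ∷ Linked-takeTo⁺ i Rxs Rzx

-- Neighbourhoods, leaves and support vertices.

module _ (G : Graph n) where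
  open Graph G

  ∈N⁺ : ∀ {v w} → Adj v w → w ∈ N G v
  ∈N⁺ {v} = ∈⟪⟫⁺ (adj? v)

  ∈N⁻ : ∀ {v w} → w ∈ N G v → Adj v w
  ∈N⁻ {v} = ∈⟪⟫⁻ (adj? v)

  ∈L⁺ : ∀ {v} → Leaf G v → v ∈ L G
  ∈L⁺ = ∈⟪⟫⁺ (leaf? G)

  ∈L⁻ : ∀ {v} → v ∈ L G → Leaf G v
  ∈L⁻ = ∈⟪⟫⁻ (leaf? G)

  ∈S⁺ : ∀ {v} → Support G v → v ∈ S G
  ∈S⁺ = ∈⟪⟫⁺ (support? G)

  ∈S⁻ : ∀ {v} → v ∈ S G → Support G v
  ∈S⁻ = ∈⟪⟫⁻ (support? G)

  leaf-neighbour-unique : ∀ {x v w} → Leaf G x → Adj x v → Adj x w → v ≡ w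
  leaf-neighbour-unique leaf xv xw = ∣p∣≡1⇒x≡y leaf (∈N⁺ xv) (∈N⁺ xw)

  another-neighbour : ∀ {x y} → ¬ Leaf G x → Adj x y → ∃[ z ] (Adj x z × z ≢ y)
  another-neighbour {x} {y} ¬leaf xy
    with any? (λ z → adj? x z ×-dec ¬? (z ≟ y))
  ... | yes other = other
  ... | no  none  = contradiction
    (ℕ.≤-antisym
      (p⊆⁅x⁆⇒∣p∣≤1 λ {z} z∈N → decidable-stable (z ≟ y) λ z≢y → none (z , ∈N⁻ z∈N , z≢y))
      (x∈p⇒1≤∣p∣ (∈N⁺ xy)))
    ¬leaf

  -- A path whose first vertex is not a leaf can be prolonged there, unless this
  -- closes a cycle; so without leaves there would be paths of any length.
  acyclic⇒leaf : Acyclic G → ∀ {x y} → Adj x y → ∃ (Leaf G)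
  acyclic⇒leaf acyclic {x} {y} xy with any? (leaf? G)
  ... | yes leaf  = leaf
  ... | no  ¬leaf with long-path (suc n)
    where
    open DecMembership (_≟_ {n}) using () renaming (_∈?_ to _∈ˡ?_)

    long-path : ∀ k → ∃[ x ] ∃[ y ] ∃[ zs ]
      (k ℕ.≤ length zs × Unique (x ∷ y ∷ zs) × Linked Adj (x ∷ y ∷ zs))
    long-path zero = x , y , [] , z≤n , ((λ { refl → irrefl xy }) ∷ []) ∷ [] ∷ [] , xy ∷ [-]
    long-path (suc k) with long-path k
    ... | x , y , zs , k≤ , uniq@(x≢ ∷ uniq′) , path@(xy ∷ path′)
      with another-neighbour (λ leaf → ¬leaf (x , leaf)) xy
    ... | z , xz , z≢y with z ∈ˡ? (x ∷ y ∷ zs)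
    ... | no  z∉ = z , x , y ∷ zs , s≤s k≤ , ¬Any⇒All¬ _ z∉ ∷ uniq , adj-sym xz ∷ path
    ... | yes (here refl)         = contradiction xz irrefl
    ... | yes (there (here z≡y))  = contradiction z≡y z≢y
    -- Here `z` lies beyond `y`, so the path from `x` to `z` and the edge back form a cycle. Its
    -- part after `x` contains `y` and a later vertex, hence has length at least 2.
    ... | yes (there i@(there j)) = contradiction
      ( All-takeTo⁺ i x≢ ∷ Unique-takeTo⁺ i uniq′
      , s≤s (1≤∣takeTo∣ j)
      , xy ∷ Linked-takeTo⁺ j path′ (adj-sym xz))
      (acyclic x (takeTo i))
  ... | x , y , zs , n<∣zs∣ , uniq , _ = contradiction
    (ℕ.≤-trans (ℕ.≤-trans (ℕ.m≤n+m _ 2) (Unique⇒length≤∣p∣ uniq (All.universal (λ _ → ∈⊤) _)))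
      (∣p∣≤n ⊤))
    (ℕ.<⇒≱ n<∣zs∣)

  -- Closed neighbourhoods and ESI-sets.

  ∈N[]⁺ : ∀ {v w} → v ≡ w ⊎ Adj v w → w ∈ N[_] G v
  ∈N[]⁺ {v} (inj₁ refl) = q⊆p∪q (N G v) ⁅ v ⁆ (x∈⁅x⁆ v)
  ∈N[]⁺ {v} (inj₂ vw)   = p⊆p∪q ⁅ v ⁆ (∈N⁺ vw)

  ∈N[]⁻ : ∀ {v w} → w ∈ N[_] G v → v ≡ w ⊎ Adj v w
  ∈N[]⁻ {v} {w} w∈ with x∈p∪q⁻ (N G v) ⁅ v ⁆ w∈
  ... | inj₁ w∈N = inj₂ (∈N⁻ w∈N)
  ... | inj₂ w∈v = inj₁ (sym (x∈⁅y⁆⇒x≡y v w∈v))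

  ∈N[]ˢ⁺ : ∀ {B b w} → b ∈ B → b ≡ w ⊎ Adj b w → w ∈ N[_]ˢ G B
  ∈N[]ˢ⁺ {B} b∈B near = ∈⟪⟫⁺ (inN[]? G B) (_ , b∈B , ∈N[]⁺ near)

  ∈N[]ˢ⁻ : ∀ {B w} → w ∈ N[_]ˢ G B → ∃[ b ] (b ∈ B × (b ≡ w ⊎ Adj b w))
  ∈N[]ˢ⁻ {B} w∈ = let b , b∈B , w∈N = ∈⟪⟫⁻ (inN[]? G B) w∈ in b , b∈B , ∈N[]⁻ w∈N

  ∈Nˢ⁻ : ∀ {B w} → w ∈ Nˢ G B → w ∉ B × ∃[ b ] (b ∈ B × Adj b w)
  ∈Nˢ⁻ {B} w∈ with ∈N[]ˢ⁻ (p─q⊆p (N[_]ˢ G B) B w∈) | x∈p─q⇒x∉q (N[_]ˢ G B) B w∈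
  ... | b , b∈B , inj₁ refl | w∉B = contradiction b∈B w∉B
  ... | b , b∈B , inj₂ bw   | w∉B = w∉B , b , b∈B , bw

  -- Unfolds membership of `y` in the complement of `N[B]`, so that later arguments speak of
  -- adjacency only.
  ExternalNeighbour : Subset n → Fin n → Set
  ExternalNeighbour B w = ∃[ y ] (Adj w y × y ∉ B × (∀ {b} → b ∈ B → ¬ Adj b y))

  ESI⁺ : ∀ {B} → (∀ {u v} → u ∈ B → v ∈ B → ¬ Adj u v) →
    (∀ {b w} → b ∈ B → Adj b w → ExternalNeighbour B w) → ESI G B
  ESI⁺ {B} indep external = (λ _ u∈ _ v∈ → indep u∈ v∈) , supported
    where
    supported : ExternallySupported G B
    supported _ v∈ with ∈Nˢ⁻ v∈
    ... | _ , b , b∈B , bv with external b∈B bv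
    ... | y , vy , y∉B , none = y , vy , x∉p⇒x∈∁p y∉N[B]
      where
      y∉N[B] : y ∉ N[_]ˢ G B
      y∉N[B] y∈ with ∈N[]ˢ⁻ y∈
      ... | b , b∈B , inj₁ refl = y∉B b∈B
      ... | b , b∈B , inj₂ by   = none b∈B by

  isolated⇒1≤αₑₛ : ∀ {v} → (∀ {w} → ¬ Adj v w) → 1 ℕ.≤ αₑₛ G
  isolated⇒1≤αₑₛ {v} isolated = subst (ℕ._≤ αₑₛ G) (∣⁅x⁆∣≡1 v)
    (αₑₛ-maximal G ⁅ v ⁆ (ESI⁺ (λ u∈ _ → ¬nbr u∈) (λ b∈ bw → contradiction bw (¬nbr b∈))))
    where
    ¬nbr : ∀ {u w} → u ∈ ⁅ v ⁆ → ¬ Adj u w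
    ¬nbr u∈ rewrite x∈⁅y⁆⇒x≡y v u∈ = isolated

  -- Chosen leaves and the lower bound.

  chosenLeaf : Fin n → Fin n
  chosenLeaf v with support? G v
  ... | yes (u , _) = u
  ... | no  _       = v

  chosenLeaf-spec : ∀ {v} → v ∈ S G → Leaf G (chosenLeaf v) × Adj (chosenLeaf v) v
  chosenLeaf-spec {v} v∈S with support? G v
  ... | yes (_ , leaf , uv) = leaf , uv
  ... | no  ¬support        = contradiction (∈S⁻ v∈S) ¬support

  -- At a leaf the neighbour found is forced, and `support-spec` identifies it.
  support : Fin n → Fin n
  support x with any? (adj? x)
  ... | yes (w , _) = w
  ... | no  _       = x

  support-spec : ∀ {x w} → Leaf G x → Adj x w → support x ≡ w
  support-spec {x} leaf xw with any? (adj? x)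
  ... | yes (_ , xv) = leaf-neighbour-unique leaf xv xw
  ... | no  none     = contradiction (_ , xw) none

  module _ (leaves-nonadjacent : ∀ {x y} → Leaf G x → Leaf G y → ¬ Adj x y) where

    -- Independence is automatic among leaves, so only external support has to be checked.
    L─-ESI : ∀ W → (∀ {x w} → x ∈ L G ─ W → Adj x w → ExternalNeighbour (L G ─ W) w) →
      ESI G (L G ─ W)
    L─-ESI W = ESI⁺ λ u∈ v∈ →
      leaves-nonadjacent (∈L⁻ (p─q⊆p (L G) W u∈)) (∈L⁻ (p─q⊆p (L G) W v∈))

    ℓ≤αₑₛ+∣W∣ : ∀ W → ESI G (L G ─ W) → ℓ G ℕ.≤ αₑₛ G + ∣ W ∣
    ℓ≤αₑₛ+∣W∣ W esi = ℕ.≤-trans (∣p∣≤∣p─q∣+∣q∣ (L G) W) (ℕ.+-monoˡ-≤ ∣ W ∣ (αₑₛ-maximal G _ esi))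

    -- The discarded leaf at `w` is adjacent to no leaf, hence lies outside the closed neighbourhood
    -- of `L - W`.
    chosenLeaf-external : ∀ {W w} → w ∈ S G → chosenLeaf w ∈ W →
      ExternalNeighbour (L G ─ W) w
    chosenLeaf-external {W} {w} w∈S c∈W = let leaf , cw = chosenLeaf-spec w∈S in
      chosenLeaf w , adj-sym cw , (λ c∈ → x∈p─q⇒x∉q (L G) W c∈ c∈W) ,
      λ b∈ → leaves-nonadjacent (∈L⁻ (p─q⊆p (L G) W b∈)) leaf

    -- Every neighbour of a remaining leaf is a support vertex, and its discarded chosen leaf
    -- supports it externally.
    ℓ≤αₑₛ+s : ℓ G ℕ.≤ αₑₛ G + s G
    ℓ≤αₑₛ+s = ℕ.≤-trans
      (ℓ≤αₑₛ+∣W∣ W (L─-ESI W λ x∈ xw →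
        let w∈S = ∈S⁺ (_ , ∈L⁻ (p─q⊆p (L G) W x∈) , xw)
        in chosenLeaf-external w∈S (∈image⁺ chosenLeaf w∈S)))
      (ℕ.+-monoʳ-≤ (αₑₛ G) (∣image∣≤ chosenLeaf (S G)))
      where W = image chosenLeaf (S G)

    -- Dropping the leaves at v keeps v outside N[B], so v itself supports its
    -- neighbours externally and all of their leaves may be used.
    ℓ+∣S∩N[v]∣≤αₑₛ+ℓᵥ+s : ∀ v → ¬ Leaf G v →
      ℓ G + ∣ S G ∩ N[_] G v ∣ ℕ.≤ αₑₛ G + ℓᵥ G v + s G
    ℓ+∣S∩N[v]∣≤αₑₛ+ℓᵥ+s v ¬leaf = begin
      ℓ G + ∣S∩N∣                                ≤⟨ ℕ.+-monoˡ-≤ ∣S∩N∣ (ℓ≤αₑₛ+∣W∣ W esi) ⟩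
      αₑₛ G + ∣ W ∣ + ∣S∩N∣                      ≤⟨ ℕ.+-monoˡ-≤ ∣S∩N∣ (ℕ.+-monoʳ-≤ (αₑₛ G) ∣W∣≤) ⟩
      αₑₛ G + (ℓᵥ G v + ∣S─N∣) + ∣S∩N∣             ≡⟨ assoc₄ (αₑₛ G) (ℓᵥ G v) ∣S─N∣ ∣S∩N∣ ⟩
      αₑₛ G + ℓᵥ G v + (∣S─N∣ + ∣S∩N∣)             ≡⟨ cong (λ k → αₑₛ G + ℓᵥ G v + k) split-S ⟩
      αₑₛ G + ℓᵥ G v + s G                     ∎
      where
      open ℕ.≤-Reasoning
      assoc₄ : ∀ a b c d → a + (b + c) + d ≡ a + b + (c + d)
      assoc₄ = solve-∀

      ∣S∩N∣ ∣S─N∣ : ℕ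
      ∣S∩N∣ = ∣ S G ∩ N[_] G v ∣
      ∣S─N∣ = ∣ S G ─ N[_] G v ∣

      split-S : ∣S─N∣ + ∣S∩N∣ ≡ s G
      split-S = ∣p─q∣+∣p∩q∣≡∣p∣ (S G) (N[_] G v)

      -- Neighbours of `v` are supported by `v`, so only support vertices outside `N[v]` still give
      -- up a chosen leaf.
      C W : Subset n
      C = image chosenLeaf (S G ─ N[_] G v)
      W = (N G v ∩ L G) ∪ C

      ∣W∣≤ : ∣ W ∣ ℕ.≤ ℓᵥ G v + ∣S─N∣
      ∣W∣≤ = ℕ.≤-trans (∣p∪q∣≤∣p∣+∣q∣ (N G v ∩ L G) C)
        (ℕ.+-monoʳ-≤ (ℓᵥ G v) (∣image∣≤ chosenLeaf _))

      v-outside : ∀ {x} → x ∈ L G ─ W → ¬ Adj x v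
      v-outside x∈ xv = x∈p─q⇒x∉q (L G) W x∈
        (p⊆p∪q C (x∈p∩q⁺ (∈N⁺ (adj-sym xv) , p─q⊆p (L G) W x∈)))

      esi : ESI G (L G ─ W)
      esi = L─-ESI W external
        where
        external : ∀ {x w} → x ∈ L G ─ W → Adj x w → ExternalNeighbour (L G ─ W) w
        external {x} {w} x∈ xw with w ∈? N[_] G v
        ... | no w∉ = let w∈S = ∈S⁺ (x , ∈L⁻ (p─q⊆p (L G) W x∈) , xw) in
          chosenLeaf-external w∈S
            (q⊆p∪q (N G v ∩ L G) C (∈image⁺ chosenLeaf (x∈p∧x∉q⇒x∈p─q w∈S w∉)))
        ... | yes w∈ with ∈N[]⁻ w∈
        ... | inj₁ refl = contradiction xw (v-outside x∈)
        ... | inj₂ vw   = v , adj-sym vw , ¬leaf ∘ ∈L⁻ ∘ p─q⊆p (L G) W , v-outside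

  -- The upper bound from the structural conditions.

  module _ (V≡S∪L : ⊤ ≡ S G ∪ L G) (1+sᵥ≤ℓᵥ : ∀ v → v ∈ S G → suc (sᵥ G v) ℕ.≤ ℓᵥ G v)
           {B : Subset n} (esi : ESI G B) where

    S⊎L : ∀ v → v ∈ S G ⊎ v ∈ L G
    S⊎L v = x∈p∪q⁻ (S G) (L G) (subst (v ∈_) V≡S∪L ∈⊤)

    external-neighbour : ∀ {b w} → b ∈ B → Adj b w → w ∉ B →
      ∃[ y ] (Adj w y × y ∈ ∁ (N[_]ˢ G B))
    external-neighbour b∈B bw w∉B =
      proj₂ esi _ (x∈p∧x∉q⇒x∈p─q (∈N[]ˢ⁺ b∈B (inj₂ bw)) w∉B)

    -- If `v` were in `B`, a leaf at `v` would lie in `N(B)`, but its only neighbour is `v` and so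
    -- it has no external neighbour.
    S∩B-empty : ∀ {v} → v ∈ S G → v ∉ B
    S∩B-empty v∈S v∈B with ∈S⁻ v∈S
    ... | x , leaf , xv
      with external-neighbour v∈B (adj-sym xv) (λ x∈B → proj₁ esi _ x∈B _ v∈B xv)
    ... | y , xy , y∈∁ with leaf-neighbour-unique leaf xv xy
    ... | refl = x∈∁p⇒x∉p y∈∁ (∈N[]ˢ⁺ v∈B (inj₁ refl))

    B⊆L : B ⊆ L G
    B⊆L {b} b∈B with S⊎L b
    ... | inj₁ b∈S = contradiction b∈B (S∩B-empty b∈S)
    ... | inj₂ b∈L = b∈L

    SpareLeaf : Fin n → Fin n → Set
    SpareLeaf v x = Adj v x × x ∈ L G ─ B

    spareLeaf? : ∀ v → Dec (∃ (SpareLeaf v))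
    spareLeaf? v = any? (λ x → adj? v x ×-dec (x ∈? (L G ─ B)))

    outer? : ∀ v → Dec (∃[ w ] (Adj v w × w ∈ ∁ (N[_]ˢ G B)))
    outer? v = any? (λ w → adj? v w ×-dec (w ∈? ∁ (N[_]ˢ G B)))

    -- A support vertex all of whose leaves lie in B is charged to an external
    -- neighbour w, none of whose leaves lie in B; there are ℓ(w) ≥ s(w) + 1 of them.
    charge : Fin n → Fin n
    charge v with spareLeaf? v | outer? v
    ... | no _  | yes (w , _) = w
    ... | yes _ | _           = v
    ... | no _  | no _        = v

    -- If no leaf at `v` is spare, all of them lie in `B`, so `v` is in `N(B)` and has an external
    -- neighbour. That neighbour is a support vertex, since as a leaf it would be spare.
    charge-spec : ∀ {v} → v ∈ S G →
      (charge v ≡ v × ∃ (SpareLeaf v)) ⊎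
      (Adj v (charge v) × charge v ∈ S G × charge v ∉ N[_]ˢ G B)
    charge-spec {v} v∈S with spareLeaf? v | outer? v
    ... | yes spare | _ = inj₁ (refl , spare)
    ... | no ¬spare | yes (w , vw , w∈∁) with S⊎L w
    ...   | inj₁ w∈S = inj₂ (vw , w∈S , x∈∁p⇒x∉p w∈∁)
    ...   | inj₂ w∈L = contradiction
      (w , vw , x∈p∧x∉q⇒x∈p─q w∈L (λ w∈B → x∈∁p⇒x∉p w∈∁ (∈N[]ˢ⁺ w∈B (inj₁ refl)))) ¬spare
    charge-spec {v} v∈S | no ¬spare | no ¬outer with ∈S⁻ v∈S
    ... | x , leaf , xv = contradiction (external-neighbour x∈B xv (S∩B-empty v∈S)) ¬outer
      where
      x∈B : x ∈ B
      x∈B = decidable-stable (x ∈? B) λ x∉B →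
        ¬spare (x , adj-sym xv , x∈p∧x∉q⇒x∈p─q (∈L⁺ leaf) x∉B)

    charge∈S : ∀ {v} → v ∈ S G → charge v ∈ S G
    charge∈S v∈S with charge-spec v∈S
    ... | inj₁ (eq , _)      = subst (_∈ S G) (sym eq) v∈S
    ... | inj₂ (_ , w∈S , _) = w∈S

    spare∈fibre : ∀ {w x} → Adj w x → x ∈ L G → x ∉ B → x ∈ (L G ─ B) ∩ fibre support w
    spare∈fibre wx x∈L x∉B = x∈p∩q⁺
      (x∈p∧x∉q⇒x∈p─q x∈L x∉B , ∈fibre⁺ support (support-spec (∈L⁻ x∈L) (adj-sym wx)))

    -- Only support vertices receive charges. If `w` is outside `N[B]`, at most `w` and its `s(w)`
    -- support neighbours are charged to it, and all its `ℓ(w)` leaves are outside `B`. If `w` is in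
    -- `N[B]`, only `w` can be charged to `w`, and then it has a spare leaf.
    fibre-≤ : ∀ w → ∣ S G ∩ fibre charge w ∣ ℕ.≤ ∣ (L G ─ B) ∩ fibre support w ∣
    fibre-≤ w with w ∈? S G | w ∈? N[_]ˢ G B | spareLeaf? w
    ... | no w∉S | _ | _ = x∉p⇒∣p∣≤k λ v∈ →
      let v∈S , v∈w = x∈p∩q⁻ (S G) _ v∈ in
      w∉S (subst (_∈ S G) (∈fibre⁻ charge v∈w) (charge∈S v∈S))
    ... | yes w∈S | no w∉N | _ = begin
      ∣ S G ∩ fibre charge w ∣           ≤⟨ p⊆q⇒∣p∣≤∣q∣ ⊆N[w] ⟩
      ∣ ⁅ w ⁆ ∪ (N G w ∩ S G) ∣          ≤⟨ ∣p∪q∣≤∣p∣+∣q∣ ⁅ w ⁆ (N G w ∩ S G) ⟩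
      ∣ ⁅ w ⁆ ∣ + sᵥ G w                 ≡⟨ cong (_+ sᵥ G w) (∣⁅x⁆∣≡1 w) ⟩
      suc (sᵥ G w)                       ≤⟨ 1+sᵥ≤ℓᵥ w w∈S ⟩
      ℓᵥ G w                             ≤⟨ p⊆q⇒∣p∣≤∣q∣ leaves-spare ⟩
      ∣ (L G ─ B) ∩ fibre support w ∣    ∎
      where
      open ℕ.≤-Reasoning
      ⊆N[w] : S G ∩ fibre charge w ⊆ ⁅ w ⁆ ∪ (N G w ∩ S G)
      ⊆N[w] {v} v∈ with x∈p∩q⁻ (S G) _ v∈
      ... | v∈S , v∈w with ∈fibre⁻ charge v∈w | charge-spec v∈S
      ... | refl | inj₁ (eq , _) = p⊆p∪q _ (subst (λ u → v ∈ ⁅ u ⁆) (sym eq) (x∈⁅x⁆ v))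
      ... | refl | inj₂ (vw , _) = q⊆p∪q ⁅ w ⁆ _ (x∈p∩q⁺ (∈N⁺ (adj-sym vw) , v∈S))
      leaves-spare : N G w ∩ L G ⊆ (L G ─ B) ∩ fibre support w
      leaves-spare x∈ = let x∈N , x∈L = x∈p∩q⁻ (N G w) (L G) x∈ in
        spare∈fibre (∈N⁻ x∈N) x∈L (λ x∈B → w∉N (∈N[]ˢ⁺ x∈B (inj₂ (adj-sym (∈N⁻ x∈N)))))
    ... | yes w∈S | yes w∈N | yes (x , wx , x∈) = ℕ.≤-trans
      (p⊆⁅x⁆⇒∣p∣≤1 ≡w)
      (x∈p⇒1≤∣p∣ (spare∈fibre wx (p─q⊆p (L G) B x∈) (x∈p─q⇒x∉q (L G) B x∈)))
      where
      ≡w : ∀ {v} → v ∈ S G ∩ fibre charge w → v ≡ w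
      ≡w v∈ with x∈p∩q⁻ (S G) _ v∈
      ... | v∈S , v∈w with ∈fibre⁻ charge v∈w | charge-spec v∈S
      ... | refl | inj₁ (eq , _)      = sym eq
      ... | refl | inj₂ (_ , _ , w∉N) = contradiction w∈N w∉N
    ... | yes w∈S | yes w∈N | no ¬spare = x∉p⇒∣p∣≤k empty
      where
      empty : ∀ {v} → v ∉ S G ∩ fibre charge w
      empty v∈ with x∈p∩q⁻ (S G) _ v∈
      ... | v∈S , v∈w with ∈fibre⁻ charge v∈w | charge-spec v∈S
      ... | refl | inj₁ (eq , spare)  = ¬spare (subst (∃ ∘ SpareLeaf) (sym eq) spare)
      ... | refl | inj₂ (_ , _ , w∉N) = w∉N w∈N

    ∣B∣+s≤ℓ : ∣ B ∣ + s G ℕ.≤ ℓ G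
    ∣B∣+s≤ℓ = begin
      ∣ B ∣ + s G                      ≤⟨ ℕ.+-mono-≤ (p⊆q⇒∣p∣≤∣q∣ (λ b∈ → x∈p∩q⁺ (B⊆L b∈ , b∈)))
                                            (fibrewise-≤ charge support (S G) (L G ─ B) fibre-≤) ⟩
      ∣ L G ∩ B ∣ + ∣ L G ─ B ∣        ≡⟨ ℕ.+-comm ∣ L G ∩ B ∣ ∣ L G ─ B ∣ ⟩
      ∣ L G ─ B ∣ + ∣ L G ∩ B ∣        ≡⟨ ∣p─q∣+∣p∩q∣≡∣p∣ (L G) B ⟩
      ℓ G                              ∎
      where open ℕ.≤-Reasoning

  -- Trees: adjacent leaves and the general lower bound.

  module _ (tree : IsTree G) where
    open IsTree tree

    -- Each of the two leaves has only the other as a neighbour, so no walk from `x` leaves the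
    -- pair.
    adjacent-leaves⇒spanning : ∀ {x y} → Leaf G x → Leaf G y → Adj x y → ∀ v → v ≡ x ⊎ v ≡ y
    adjacent-leaves⇒spanning {x} {y} leafˣ leafʸ xy v = closed (inj₁ refl) (connected x v)
      where
      closed : ∀ {u v} → u ≡ x ⊎ u ≡ y → Star Adj u v → v ≡ x ⊎ v ≡ y
      closed u∈          ε        = u∈
      closed (inj₁ refl) (xw ◅ p) = closed (inj₂ (leaf-neighbour-unique leafˣ xw xy)) p
      closed (inj₂ refl) (yw ◅ p) = closed (inj₁ (leaf-neighbour-unique leafʸ yw (adj-sym xy))) p

    adjacent-leaves⇒n≡2 : ∀ {x y} → Leaf G x → Leaf G y → Adj x y → n ≡ 2
    adjacent-leaves⇒n≡2 {x} {y} leafˣ leafʸ xy = ℕ.≤-antisym n≤2 2≤n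
      where
      open ℕ.≤-Reasoning
      n≤2 : n ℕ.≤ 2
      n≤2 = begin
        n                        ≡⟨ ∣⊤∣≡n n ⟨
        ∣ ⊤ {n} ∣                ≤⟨ p⊆q⇒∣p∣≤∣q∣ {p = ⊤} ⊤⊆xy ⟩
        ∣ ⁅ x ⁆ ∪ ⁅ y ⁆ ∣        ≤⟨ ∣p∪q∣≤∣p∣+∣q∣ ⁅ x ⁆ ⁅ y ⁆ ⟩
        ∣ ⁅ x ⁆ ∣ + ∣ ⁅ y ⁆ ∣    ≡⟨ cong₂ _+_ (∣⁅x⁆∣≡1 x) (∣⁅x⁆∣≡1 y) ⟩
        2                        ∎
        where
        ∈⁅⁆ : ∀ {u v : Fin n} → v ≡ u → v ∈ ⁅ u ⁆
        ∈⁅⁆ refl = x∈⁅x⁆ _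
        ⊤⊆xy : ⊤ ⊆ ⁅ x ⁆ ∪ ⁅ y ⁆
        ⊤⊆xy {v} _ = x∈p∪q⁺
          (Sum.map ∈⁅⁆ ∈⁅⁆ (adjacent-leaves⇒spanning leafˣ leafʸ xy v))
      2≤n : 2 ℕ.≤ n
      2≤n = ℕ.≤-trans
        (Unique⇒length≤∣p∣ {xs = x ∷ y ∷ []}
          (((λ { refl → irrefl xy }) ∷ []) ∷ [] ∷ []) (∈⊤ ∷ ∈⊤ ∷ []))
        (∣p∣≤n ⊤)

    -- Both vertices of `K_2` are support vertices, so in this case the lower bound is at most 0.
    adjacent-leaves⇒ℓ≤s : ∀ {x y} → Leaf G x → Leaf G y → Adj x y → ℓ G ℕ.≤ s G
    adjacent-leaves⇒ℓ≤s leafˣ leafʸ xy = p⊆q⇒∣p∣≤∣q∣ {p = L G} {q = S G} λ {v} _ → ∈S⁺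
      ([ (λ { refl → _ , leafʸ , adj-sym xy }) , (λ { refl → _ , leafˣ , xy }) ]′
        (adjacent-leaves⇒spanning leafˣ leafʸ xy v))

    tree-ℓ≤αₑₛ+s : ℓ G ℕ.≤ αₑₛ G + s G
    tree-ℓ≤αₑₛ+s with any? (λ x → any? (λ y → leaf? G x ×-dec leaf? G y ×-dec adj? x y))
    ... | yes (_ , _ , leafˣ , leafʸ , xy) =
      ℕ.≤-trans (adjacent-leaves⇒ℓ≤s leafˣ leafʸ xy) (ℕ.m≤n+m (s G) (αₑₛ G))
    ... | no  none = ℓ≤αₑₛ+s λ leafˣ leafʸ xy → none (_ , _ , leafˣ , leafʸ , xy)

    -- Consequences of equality.

    module _ (leaves-nonadjacent : ∀ {x y} → Leaf G x → Leaf G y → ¬ Adj x y)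
             (αₑₛ+s≤ℓ : αₑₛ G + s G ℕ.≤ ℓ G) where

      ∣S∩N[v]∣≤ℓᵥ : ∀ {v} → ¬ Leaf G v → ∣ S G ∩ N[_] G v ∣ ℕ.≤ ℓᵥ G v
      ∣S∩N[v]∣≤ℓᵥ {v} ¬leaf = ℕ.+-cancelˡ-≤ (αₑₛ G + s G) _ _ (begin
        αₑₛ G + s G + ∣ S G ∩ N[_] G v ∣    ≤⟨ ℕ.+-monoˡ-≤ _ αₑₛ+s≤ℓ ⟩
        ℓ G + ∣ S G ∩ N[_] G v ∣            ≤⟨ ℓ+∣S∩N[v]∣≤αₑₛ+ℓᵥ+s leaves-nonadjacent v ¬leaf ⟩
        αₑₛ G + ℓᵥ G v + s G                ≡⟨ swap (αₑₛ G) (ℓᵥ G v) (s G) ⟩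
        αₑₛ G + s G + ℓᵥ G v                ∎)
        where
        open ℕ.≤-Reasoning
        swap : ∀ a b c → a + b + c ≡ a + c + b
        swap = solve-∀

      -- The extra one is `v` itself, which belongs to `S` and `N[v]` but not to `N(v)`.
      1+sᵥ≤ℓᵥ : ∀ {v} → v ∈ S G → suc (sᵥ G v) ℕ.≤ ℓᵥ G v
      1+sᵥ≤ℓᵥ {v} v∈S = ℕ.≤-trans 1+sᵥ≤ (∣S∩N[v]∣≤ℓᵥ ¬leaf)
        where
        ¬leaf : ¬ Leaf G v
        ¬leaf leaf = let _ , leafˣ , xv = ∈S⁻ v∈S in leaves-nonadjacent leafˣ leaf xv
        N∩S⊂S∩N[v] : N G v ∩ S G ⊂ S G ∩ N[_] G v
        N∩S⊂S∩N[v] =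
          (λ u∈ → let u∈N , u∈S = x∈p∩q⁻ (N G v) (S G) u∈ in
            x∈p∩q⁺ (u∈S , ∈N[]⁺ (inj₂ (∈N⁻ u∈N)))) ,
          v , x∈p∩q⁺ (v∈S , ∈N[]⁺ (inj₁ refl)) ,
          λ v∈ → irrefl (∈N⁻ (p∩q⊆p (N G v) (S G) v∈))
        1+sᵥ≤ : suc (sᵥ G v) ℕ.≤ ∣ S G ∩ N[_] G v ∣
        1+sᵥ≤ = p⊂q⇒∣p∣<∣q∣ N∩S⊂S∩N[v]

      Inner : Fin n → Set
      Inner v = ¬ Leaf G v × ¬ Support G v

      -- An inner `v` has no leaves, so `S ∩ N[v]` is empty by the exchange bound and `w` is not a
      -- support vertex. As a leaf, `w` would make `v` a support vertex.
      inner-neighbour : ∀ {v w} → Inner v → Adj v w → Inner w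
      inner-neighbour {v} (¬leaf , ¬support) vw =
        (λ leaf → ¬support (_ , leaf , adj-sym vw)) ,
        λ support-w → ℕ.n≮0 (ℕ.≤-trans
          (x∈p⇒1≤∣p∣ (x∈p∩q⁺ (∈S⁺ support-w , ∈N[]⁺ (inj₂ vw))))
          (ℕ.≤-trans (∣S∩N[v]∣≤ℓᵥ ¬leaf) (x∉p⇒∣p∣≤k λ x∈ →
            let x∈N , x∈L = x∈p∩q⁻ (N G v) (L G) x∈ in
            ¬support (_ , ∈L⁻ x∈L , adj-sym (∈N⁻ x∈N)))))

      inner-reachable : ∀ {v w} → Inner v → Star Adj v w → Inner w
      inner-reachable inner ε        = inner
      inner-reachable inner (vw ◅ p) = inner-reachable (inner-neighbour inner vw) p

      -- By connectedness one inner vertex makes all vertices inner, so there are no leaves.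
      -- Acyclicity then forbids edges, and the isolated vertex gives `αₑₛ ≥ 1` against `ℓ = 0`.
      no-inner : ∀ v → ¬ Inner v
      no-inner v inner = ℕ.n≮0 (begin
        1              ≤⟨ isolated⇒1≤αₑₛ {v} isolated ⟩
        αₑₛ G          ≤⟨ ℕ.m≤m+n (αₑₛ G) (s G) ⟩
        αₑₛ G + s G    ≤⟨ αₑₛ+s≤ℓ ⟩
        ℓ G            ≤⟨ x∉p⇒∣p∣≤k {p = L G} (λ {x} → no-leaf x ∘ ∈L⁻) ⟩
        0              ∎)
        where
        open ℕ.≤-Reasoning
        no-leaf : ∀ x → ¬ Leaf G x
        no-leaf x = proj₁ (inner-reachable inner (connected v x))
        isolated : ∀ {w} → ¬ Adj v w
        isolated vw = let x , leaf = acyclic⇒leaf acyclic vw in no-leaf x leaf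

      V≡S∪L : ⊤ ≡ S G ∪ L G
      V≡S∪L = ⊆-antisym (λ {v} _ → x∈p∪q⁺ (support-or-leaf v)) ⊆⊤
        where
        support-or-leaf : ∀ v → v ∈ S G ⊎ v ∈ L G
        support-or-leaf v with support? G v | leaf? G v
        ... | yes support | _        = inj₁ (∈S⁺ support)
        ... | no  _       | yes leaf = inj₂ (∈L⁺ leaf)
        ... | no ¬support | no ¬leaf = contradiction (¬leaf , ¬support) (no-inner v)

-- Passage between integers and natural numbers, and the theorem.

m≤n+o⇒m-o≤n : ∀ {m n o} → m ℕ.≤ n + o → + m - + o ≤ + n
m≤n+o⇒m-o≤n {m} {n} {o} m≤n+o = subst (+ m - + o ≤_) (//-rightDividesʳ (+ o) (+ n))
  (ℤ.+-monoˡ-≤ (ℤ.- + o) (ℤ.+≤+ m≤n+o))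

n≡m-o⇒n+o≡m : ∀ {m n o} → + n ≡ + m - + o → n + o ≡ m
n≡m-o⇒n+o≡m {m} {n} {o} n≡m-o =
  ℤ.+-injective (trans (cong (ℤ._+ + o) n≡m-o) (//-rightDividesˡ (+ o) (+ m)))

n+o≡m⇒n≡m-o : ∀ {m n o} → n + o ≡ m → + n ≡ + m - + o
n+o≡m⇒n≡m-o {n = n} {o} refl = sym (//-rightDividesʳ (+ o) (+ n))

-- Subtraction is not truncated: for `n = 0` the right side is -1, so the hypothesis is impossible
-- and only the successor case remains.
m≤n-1⇒1+m≤n : ∀ {m n} → + m ≤ + n - + 1 → suc m ℕ.≤ n
m≤n-1⇒1+m≤n {n = suc n} (ℤ.+≤+ m≤n) = s≤s m≤n

1+m≤n⇒m≤n-1 : ∀ {m n} → suc m ℕ.≤ n → + m ≤ + n - + 1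
1+m≤n⇒m≤n-1 (s≤s m≤n) = ℤ.+≤+ m≤n

theorem16 : ∀ {n : ℕ} (T : Graph n) → IsTree T →
    (+ αₑₛ T ≥ + ℓ T - + s T)
    × (n ≢ 2 →
    (+ αₑₛ T ≡ + ℓ T - + s T)
    ⇔ (⊤ ≡ S T ∪ L T
    × (∀ v → v ∈ S T → + sᵥ T v ≤ + ℓᵥ T v - + 1)))
theorem16 T tree = m≤n+o⇒m-o≤n (tree-ℓ≤αₑₛ+s T tree) , λ n≢2 →
  -- `K_2` is a genuine exception: there `αₑₛ = 0 = 2 - 2`, while `s(v) = ℓ(v) = 1` at both
  -- vertices. Excluding it makes leaves nonadjacent.
  let leaves-nonadjacent : ∀ {x y} → Leaf T x → Leaf T y → ¬ Graph.Adj T x y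
      leaves-nonadjacent leafˣ leafʸ xy = n≢2 (adjacent-leaves⇒n≡2 T tree leafˣ leafʸ xy)
  in mk⇔
    (λ αₑₛ≡ℓ-s →
      let αₑₛ+s≤ℓ = ℕ.≤-reflexive (n≡m-o⇒n+o≡m αₑₛ≡ℓ-s)
      in V≡S∪L T tree leaves-nonadjacent αₑₛ+s≤ℓ ,
         λ _ v∈S → 1+m≤n⇒m≤n-1 (1+sᵥ≤ℓᵥ T tree leaves-nonadjacent αₑₛ+s≤ℓ v∈S))
    (λ (V≡S∪L , sᵥ≤ℓᵥ-1) →
      -- The bound on a single ESI-set is applied to one of maximum size.
      let B , esi , ∣B∣≡αₑₛ = αₑₛ-attained T
          αₑₛ+s≤ℓ = subst (λ k → k + s T ℕ.≤ ℓ T) ∣B∣≡αₑₛ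
            (∣B∣+s≤ℓ T V≡S∪L (λ v v∈S → m≤n-1⇒1+m≤n (sᵥ≤ℓᵥ-1 v v∈S)) esi)
      in n+o≡m⇒n≡m-o (ℕ.≤-antisym αₑₛ+s≤ℓ (tree-ℓ≤αₑₛ+s T tree)))
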